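{- Let $G$, $\{f_v\}_{v\in V}$, $S$, $T$ be an instance of the cLPI problem and let a Threshold Blocking (TB) oracle be given. If $\mathbf{x}$ is an output of the Incremental Interdiction algorithm, $t$ is the number of iterations of its outer while loop before terminating, and $\mathbf{x}^*$ is an optimal solution to the cLPI instance, then $$\|\mathbf{x}\|\le \|\mathbf{x}^*\|\cdot O\Big(t\,\ln\frac{|\mathcal{F}|\,\varepsilon^{ -1}}{t}\Big).$$
   Context: cLPI instance: a directed graph $G=(V,E)$; for each $v\in V$ a monotone non-decreasing function $f_v:\mathbb{R}_{\ge0}\to\mathbb{R}_{\ge0}$; a set $S$ of target pairs of nodes; a threshold $T$. Impact vectors are nonnegative vectors indexed by $V$, with $\|\mathbf{x}\|=\sum_v x_v$. For a path $p$ (identified with its sequence of nodes), $d_{\mathbf{x}}(p)=\min(\sum_{v\in p}f_v(x_v),T)$, and $d_{\mathbf{x}}(u,v)$ is the minimum of $d_{\mathbf{x}}(p)$ over paths $p$ from $u$ to $v$. The cLPI problem asks for an impact vector $\mathbf{x}$ with minimum $\|\mathbf{x}\|$ such that $d_{\mathbf{x}}(s,t)\ge T$ for all $(s,t)\in S$. A simple path is a path visiting no node more than once. $\mathcal{F}$ is the set of all feasible paths: simple paths $p$ connecting some pair in $S$ with $\sum_{v\in p}f_v(0)<T$. $\varepsilon\in(0,1)$ is an accuracy parameter. TB oracle: given a set $\mathcal{P}$ of feasible paths and an impact vector $\mathbf{x}$, it returns a nonnegative vector $\mathbf{s}$ with $d_{\mathbf{x}+\mathbf{s}}(p)\ge T(1-\varepsilon)$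 for all $p\in\mathcal{P}$ and $\|\mathbf{s}\|\le O(\ln(|\mathcal{P}|\varepsilon^{ -1}))\,\|\mathbf{s}^*\|$, where $\mathbf{s}^*$ is a nonnegative vector of minimum $\|\mathbf{s}^*\|$ such that $d_{\mathbf{x}+\mathbf{s}^*}(p)\ge T$ for all $p\in\mathcal{P}$. Incremental Interdiction algorithm (with a positive integer parameter $k$): Start with $\mathbf{x}=\mathbf{0}$. While there is $(s,t)\in S$ with $d_{\mathbf{x}}(s,t)<T(1-\varepsilon)$ (outer loop): set $\mathcal{P}=\emptyset$; for each pair $(s,t)\in S$ with $d_{\mathbf{x}}(s,t)<T(1-\varepsilon)$, let $K$ be the $k$ shortest simple paths from $s$ to $t$ under $\mathbf{x}$, remove from $K$ the paths $p$ with $d_{\mathbf{x}}(p)\ge T(1-\varepsilon)$, and set $\mathcal{P}\leftarrow\mathcal{P}\cup K$; then run the TB oracle on $\mathcal{P}$ and $\mathbf{x}$ (with $G,\{f_v\},T,\varepsilon$) to get $\mathbf{s}$ and set $\mathbf{x}\leftarrow\mathbf{x}+\mathbf{s}$. Return $\mathbf{x}$. The constant hidden in the final $O(\cdot)$ depends only on the constant in the oracle's guarantee. -}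

module Defs where

open import Level using (0ℓ)
open import Algebra.Bundles using (CommutativeRing)
import Algebra.Construct.NaturalChoice.Min as Min
import Algebra.Properties.CommutativeMonoid.Sum as Sum
import Algebra.Properties.Semiring.Exp as Exp
import Algebra.Properties.Semiring.Mult as Mult
open import Data.Fin.Base using (Fin)
open import Data.List.Base using (List; []; map; foldr; head; last; length)
open import Data.List.Membership.Propositional using (_∈_; _∉_)
open import Data.List.Relation.Unary.All using (All)
open import Data.List.Relation.Unary.Linked using (Linked)
open import Data.List.Relation.Unary.Unique.Propositional using (Unique)
open import Data.Maybe.Base using (just)
open import Data.Nat.Base as ℕ using (ℕ; suc)
open import Data.Product.Base using (∃; ∃₂; _×_)
open import Data.Sum.Base using (_⊎_)
open import Function.Bundles using (_⇔_)
open import Relation.Binary.Bundles using (DecTotalOrder)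
open import Relation.Binary.Core using (Rel)
open import Relation.Binary.Structures using (IsDecTotalOrder)
import Relation.Binary.Construct.NonStrictToStrict as NonStrictToStrict
open import Relation.Binary.PropositionalEquality.Core using (_≡_; _≢_)
open import Relation.Nullary.Negation.Core using (¬_)
open import Relation.Unary using (Pred)

-- A list of the elements of a finite set without repetition, so that
-- its length is the cardinality of the set.
Enumerates : {A : Set} → List A → Pred A 0ℓ → Set
Enumerates xs P = Unique xs × (∀ a → a ∈ xs ⇔ P a)

-- The classical axioms that determine the real numbers up to unique
-- isomorphism.  Inversion is total; its value at 0 is unspecified.
record CompleteOrderedField : Set₁ where
  infix 4 _≤_
  infix 8 _⁻¹
  field
    commutativeRing : CommutativeRing 0ℓ 0ℓ
  open CommutativeRing commutativeRing public
    renaming (Carrier to ℝ)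
  field
    _⁻¹             : ℝ → ℝ
    _≤_             : Rel ℝ 0ℓ
    0≉1             : 0# ≉ 1#
    *-inverseʳ      : ∀ x → x ≉ 0# → x * x ⁻¹ ≈ 1#
    isDecTotalOrder : IsDecTotalOrder _≈_ _≤_
    +-monoˡ-≤       : ∀ z {x y} → x ≤ y → x + z ≤ y + z
    *-nonneg        : ∀ {x y} → 0# ≤ x → 0# ≤ y → 0# ≤ x * y

  UpperBound : Pred ℝ 0ℓ → Pred ℝ 0ℓ
  UpperBound P b = ∀ x → P x → x ≤ b

  field
    supremum : (P : Pred ℝ 0ℓ) → ∃ P → ∃ (UpperBound P) →
               ∃ λ b → UpperBound P b × (∀ c → UpperBound P c → b ≤ c)

  decTotalOrder : DecTotalOrder 0ℓ 0ℓ 0ℓ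
  decTotalOrder = record { isDecTotalOrder = isDecTotalOrder }

  open NonStrictToStrict _≈_ _≤_ public using (_<_)
  open Min (DecTotalOrder.totalOrder decTotalOrder) public using (_⊓_)
  open Sum +-commutativeMonoid public using (sum)
  open Exp semiring public using (_^_)
  open Mult semiring public using () renaming (_×_ to _·_)

  fromℕ : ℕ → ℝ
  fromℕ n = n · 1#

  ConvergesTo : (ℕ → ℝ) → ℝ → Set
  ConvergesTo a l = ∀ δ → 0# < δ → ∃ λ N → ∀ n → N ℕ.≤ n →
                    l - δ < a n × a n < l + δ

  -- IsExp y z says z = e^y, where e^y = lim (1 + y / n)^n; the junk
  -- term n = 0 does not affect the limit.
  IsExp : ℝ → ℝ → Set
  IsExp y z = ConvergesTo (λ n → (1# + y * fromℕ n ⁻¹) ^ n) z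

  IsNaturalLog : (ℝ → ℝ) → Set
  IsNaturalLog ln = ∀ z → 0# < z → IsExp (ln z) z

module cLPI (R : CompleteOrderedField) where
  open CompleteOrderedField R

  record ℝ≥0 : Set where
    constructor _,≥0_
    field
      value  : ℝ
      nonneg : 0# ≤ value
  open ℝ≥0 public

  0≥0 : ℝ≥0
  0≥0 = 0# ,≥0 DecTotalOrder.refl decTotalOrder

  _+≥0_ : ℝ≥0 → ℝ≥0 → ℝ≥0
  (x ,≥0 0≤x) +≥0 (y ,≥0 0≤y) = (x + y) ,≥0 0≤x+y
    where
    open DecTotalOrder decTotalOrder
      using (≤-respˡ-≈) renaming (trans to ≤-trans)
    0≤x+y : 0# ≤ x + y
    0≤x+y = ≤-trans 0≤y (≤-respˡ-≈ (+-identityˡ y) (+-monoˡ-≤ y 0≤x))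

  record Instance : Set₁ where
    field
      ∣V∣    : ℕ
    V : Set
    V = Fin ∣V∣
    field
      _⟶_    : Rel V 0ℓ
      f      : V → ℝ≥0 → ℝ≥0
      f-mono : ∀ v {a b} → value a ≤ value b → value (f v a) ≤ value (f v b)
      S      : Rel V 0ℓ
      T      : ℝ

  module Paths (I : Instance) where
    open Instance I public

    Impact : Set
    Impact = V → ℝ≥0

    0ᵛ : Impact
    0ᵛ _ = 0≥0

    infixl 6 _⊕_
    _⊕_ : Impact → Impact → Impact
    (x ⊕ y) v = x v +≥0 y v

    ‖_‖ : Impact → ℝ
    ‖ x ‖ = sum (λ v → value (x v))

    IsMinimal : Pred Impact 0ℓ → Pred Impact 0ℓ
    IsMinimal Q x = Q x × (∀ y → Q y → ‖ x ‖ ≤ ‖ y ‖)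

    Path : Set
    Path = List V

    IsPath : V → V → Path → Set
    IsPath u v p = head p ≡ just u × last p ≡ just v × Linked _⟶_ p

    IsSimplePath : V → V → Path → Set
    IsSimplePath u v p = IsPath u v p × Unique p

    weight : Impact → Path → ℝ
    weight x p = foldr _+_ 0# (map (λ v → value (f v (x v))) p)

    d : Impact → Path → ℝ
    d x p = weight x p ⊓ T

    -- IsDistance x u v r says d_x(u,v) = r.  As path lengths are
    -- truncated at T, the distance is T when no path from u to v exists.
    IsDistance : Impact → V → V → ℝ → Set
    IsDistance x u v r =
        ((∃ λ p → IsPath u v p × d x p ≈ r) × (∀ p → IsPath u v p → r ≤ d x p))
      ⊎ ((∀ p → ¬ IsPath u v p) × r ≈ T)

    DistanceAtLeast : Impact → V → V → ℝ → Set
    DistanceAtLeast x u v c = ∃ λ r → IsDistance x u v r × c ≤ r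

    DistanceBelow : Impact → V → V → ℝ → Set
    DistanceBelow x u v c = ∃ λ r → IsDistance x u v r × r < c

    IsSolution : Pred Impact 0ℓ
    IsSolution x = ∀ s t → S s t → DistanceAtLeast x s t T

    IsOptimalSolution : Pred Impact 0ℓ
    IsOptimalSolution = IsMinimal IsSolution

    IsFeasiblePath : Pred Path 0ℓ
    IsFeasiblePath p =
      (∃₂ λ s t → S s t × IsSimplePath s t p) × weight 0ᵛ p < T

    -- If there are fewer than k simple paths, K consists of all of them.
    -- Ties between paths of equal length may be broken arbitrarily.
    AreShortestSimplePaths : ℕ → Impact → V → V → List Path → Set
    AreShortestSimplePaths k x s t K =
        Unique K
      × All (IsSimplePath s t) K
      × length K ℕ.≤ k
      × (length K ≡ k ⊎ (∀ p → IsSimplePath s t p → p ∈ K))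
      × (∀ p q → p ∈ K → IsSimplePath s t q → q ∉ K → d x p ≤ d x q)

    module Algorithm (ln : ℝ → ℝ) (ε : ℝ) where

      -- T(1 - ε)
      T⁻ : ℝ
      T⁻ = T * (1# - ε)

      Blocks : Impact → List Path → Pred Impact 0ℓ
      Blocks x P s = All (λ p → T ≤ d (x ⊕ s) p) P

      Oracle : Set
      Oracle = List Path → Impact → Impact

      -- C is the constant hidden in the O(·) of the guarantee.  The empty
      -- set of paths is excluded because ln 0 is undefined.
      IsTBOracle : ℝ → Oracle → Set
      IsTBOracle C oracle =
        ∀ P x → P ≢ [] → Unique P → All IsFeasiblePath P →
        let s = oracle P x in
          All (λ p → T⁻ ≤ d (x ⊕ s) p) P
        × ∃ λ s* → IsMinimal (Blocks x P) s*
                 × ‖ s ‖ ≤ (C * ln (fromℕ (length P) * ε ⁻¹)) * ‖ s* ‖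

      Continue : Pred Impact 0ℓ
      Continue x = ∃₂ λ s t → S s t × DistanceBelow x s t T⁻

      -- P is a set of paths that one iteration may pass to the oracle
      -- from the current vector x.
      Collects : ℕ → Impact → List Path → Set
      Collects k x P = ∃ λ (K : V → V → List Path) →
          (∀ s t → S s t → DistanceBelow x s t T⁻ →
             AreShortestSimplePaths k x s t (K s t))
        × Enumerates P (λ p → ∃₂ λ s t →
             S s t × DistanceBelow x s t T⁻ × p ∈ K s t × ¬ (T⁻ ≤ d x p))

      -- Reaches k oracle t x: the current vector is x after t iterations
      -- of the outer loop.
      data Reaches (k : ℕ) (oracle : Oracle) : ℕ → Impact → Set where
        start : Reaches k oracle 0 0ᵛ
        step  : ∀ {t x P} → Reaches k oracle t x → Continue x →
                Collects k x P →
                Reaches k oracle (suc t) (x ⊕ oracle P x)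

      Outputs : ℕ → Oracle → ℕ → Impact → Set
      Outputs k oracle t x = Reaches k oracle t x × ¬ Continue x

{-# OPTIONS --safe #-}
module Submission where

-- A path handed to the oracle is blocked up to T (1 − ε) from then on, so
-- the sets P₁, …, Pₜ of the t iterations are disjoint sets of feasible paths
-- and their sizes add up to at most ∣𝓕∣.  The optimal x* blocks every Pᵢ, so
-- the i-th iteration costs at most C ln(∣Pᵢ∣/ε) ‖x*‖, and concavity of ln
-- bounds the sum of the logarithms by t ln(∣𝓕∣/(ε t)).
--
-- Concavity enters as ln a ≤ ln m + a/m − 1, which follows from the
-- tangent inequality v ^ n ≥ u ^ n + n u ^ (n − 1) (v − u) for u = 1 + ln m / n and
-- v = 1 + ln a / n as n → ∞.

open import Defs
open import Algebra.Bundles using (CommutativeRing)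
open import Algebra.Bundles.Raw using (RawRing)
import Algebra.Construct.NaturalChoice.Min as Min
import Algebra.Properties.CommutativeMonoid.Sum as Sum
import Algebra.Properties.Group as GroupProperties
import Algebra.Properties.Monoid.Mult.TCOptimised as OptimisedMult
import Algebra.Properties.Ring as RingProperties
import Algebra.Properties.Semiring.Mult as Mult
import Algebra.Solver.Ring as RingSolver
open import Algebra.Solver.Ring.AlmostCommutativeRing
  using (AlmostCommutativeRing; fromCommutativeRing; -raw-almostCommutative⟶;
         _-Raw-AlmostCommutative⟶_; Induced-equivalence)
open import Data.Fin.Base using (Fin; zero; suc)
import Data.Fin.Properties as Fin
open import Data.List.Base using (List; []; _∷_; _++_; length)
import Data.List.Membership.DecPropositional as DecMembership
open import Data.List.Membership.Propositional using (_∈_)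
open import Data.List.Membership.Propositional.Properties
  using (∈-∃++; ∈-++⁻; ∈-++⁺ˡ; ∈-++⁺ʳ)
import Data.List.Properties as List
open import Data.List.Relation.Unary.All as All using (All; []; _∷_)
open import Data.List.Relation.Unary.All.Properties
  using (¬Any⇒All¬) renaming (++⁺ to All-++⁺)
open import Data.List.Relation.Unary.AllPairs using ([]; _∷_)
open import Data.List.Relation.Unary.Any using (here; there)
open import Data.List.Relation.Unary.Linked using ([-]; _∷_)
open import Data.List.Relation.Unary.Unique.Propositional using (Unique)
open import Data.List.Relation.Unary.Unique.Propositional.Properties
  using () renaming (++⁺ to Unique-++⁺)
open import Data.Maybe.Base using (nothing; just)
open import Data.Nat.Base as ℕ using (ℕ; zero; suc; NonZero; _∸_)
import Data.Nat.Properties as ℕ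
open import Data.Product.Base using (∃; ∃₂; _×_; _,_; proj₁; proj₂)
open import Data.Product.Properties using (≡-dec)
open import Data.Sum.Base using (inj₁; inj₂)
open import Function.Base using (_∘_)
open import Function.Bundles using (Equivalence)
open import Level using (0ℓ)
open import Relation.Binary.Bundles using (DecTotalOrder)
import Relation.Binary.Construct.NonStrictToStrict as NonStrictToStrict
open import Relation.Binary.Definitions using (WeaklyDecidable)
import Relation.Binary.PropositionalEquality as ≡
open ≡ using (_≡_)
import Relation.Binary.Reasoning.Setoid as SetoidReasoning
open import Relation.Nullary using (yes; no; ¬_; contradiction)
open import Relation.Nullary.Decidable using (decidable-stable)

-- Ring solver with integer coefficients.

-- A coefficient (m , n) stands for the integer m − n; keeping one
-- component zero lets the solver recognise cancellation, which it cannot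
-- do with coefficients taken from an abstract ring.
module IntegerCoefficients {c ℓ} (R : CommutativeRing c ℓ) where
  open CommutativeRing R
  open Mult semiring using (×-homo-+; ×1-homo-*) renaming (_×_ to _·_)
  open OptimisedMult +-monoid using () renaming (_×_ to _·′_; ×ᵤ≈× to ·≈·′)
  open RingProperties ring
    using (-‿distribˡ-*; -‿distribʳ-*; -‿involutive; -‿+-comm; -0#≈0#;
           ⁻¹-anti-homo‿-)
  open SetoidReasoning setoid

  private
    target : AlmostCommutativeRing c ℓ
    target = fromCommutativeRing R
    module S = RingSolver (AlmostCommutativeRing.rawRing target) target
                 (-raw-almostCommutative⟶ target) (λ _ _ → nothing)

  Coefficient : Set
  Coefficient = ℕ × ℕ

  -- The optimised multiple and the separate clause for a zero second component make `(0 , 0)` and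
  -- `(1 , 0)` compute to `0#` and `1#`.
  ⟦_⟧ᶜ : Coefficient → Carrier
  ⟦ m , zero ⟧ᶜ  = m ·′ 1#
  ⟦ m , suc n ⟧ᶜ = m ·′ 1# - suc n ·′ 1#

  ⟦⟧ᶜ≈ : ∀ m n → ⟦ m , n ⟧ᶜ ≈ m · 1# - n · 1#
  ⟦⟧ᶜ≈ m zero = begin
    m ·′ 1#           ≈⟨ ·≈·′ m 1# ⟨
    m · 1#            ≈⟨ +-identityʳ _ ⟨
    m · 1# + 0#       ≈⟨ +-congˡ -0#≈0# ⟨
    m · 1# - 0#       ∎
  ⟦⟧ᶜ≈ m (suc n) = sym (+-cong (·≈·′ m 1#) (-‿cong (·≈·′ (suc n) 1#)))

  _⊖_ : ℕ → ℕ → Coefficient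
  m ⊖ n = m ∸ n , n ∸ m

  ⊖-homo : ∀ m n → ⟦ m ⊖ n ⟧ᶜ ≈ m · 1# - n · 1#
  ⊖-homo zero    zero    = ⟦⟧ᶜ≈ 0 0
  ⊖-homo zero    (suc n) = ⟦⟧ᶜ≈ 0 (suc n)
  ⊖-homo (suc m) zero    = ⟦⟧ᶜ≈ (suc m) 0
  ⊖-homo (suc m) (suc n) = begin
    ⟦ m ⊖ n ⟧ᶜ                            ≈⟨ ⊖-homo m n ⟩
    m · 1# - n · 1#                      ≈⟨ +-identityˡ _ ⟨
    -- The coefficient test of `S` never succeeds, so the cancelling pair is inserted by hand and
    -- `S` only rearranges.
    0# + (m · 1# - n · 1#)               ≈⟨ +-congʳ (-‿inverseʳ 1#) ⟨
    (1# - 1#) + (m · 1# - n · 1#)        ≈⟨ S.solve 3 (λ o x y → (o S.:- o) S.:+ (x S.:- y)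
                                              S.:= (o S.:+ x) S.:- (o S.:+ y)) refl 1# (m · 1#) (n · 1#) ⟩
    (1# + m · 1#) - (1# + n · 1#)        ∎

  coefficients : RawRing 0ℓ 0ℓ
  coefficients = record
    { Carrier = Coefficient
    ; _≈_     = _≡_
    ; _+_     = λ (a , b) (c , d) → (a ℕ.+ c) ⊖ (b ℕ.+ d)
    ; _*_     = λ (a , b) (c , d) → (a ℕ.* c ℕ.+ b ℕ.* d) ⊖ (a ℕ.* d ℕ.+ b ℕ.* c)
    ; -_      = λ (a , b) → (b , a)
    ; 0#      = 0 , 0
    ; 1#      = 1 , 0
    }

  morphism : coefficients -Raw-AlmostCommutative⟶ target
  morphism = record
    { ⟦_⟧    = ⟦_⟧ᶜ
    ; +-homo = λ (a , b) (c , d) → begin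
        ⟦ (a ℕ.+ c) ⊖ (b ℕ.+ d) ⟧ᶜ                   ≈⟨ ⊖-homo (a ℕ.+ c) (b ℕ.+ d) ⟩
        (a ℕ.+ c) · 1# - (b ℕ.+ d) · 1#              ≈⟨ +-cong (×-homo-+ 1# a c) (-‿cong (×-homo-+ 1# b d)) ⟩
        (a · 1# + c · 1#) - (b · 1# + d · 1#)        ≈⟨ S.solve 4 (λ a b c d → (a S.:+ c) S.:- (b S.:+ d)
                                                          S.:= (a S.:- b) S.:+ (c S.:- d)) refl _ _ _ _ ⟩
        (a · 1# - b · 1#) + (c · 1# - d · 1#)        ≈⟨ +-cong (⟦⟧ᶜ≈ a b) (⟦⟧ᶜ≈ c d) ⟨
        ⟦ a , b ⟧ᶜ + ⟦ c , d ⟧ᶜ                      ∎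
    ; *-homo = λ (a , b) (c , d) → begin
        ⟦ (a ℕ.* c ℕ.+ b ℕ.* d) ⊖ (a ℕ.* d ℕ.+ b ℕ.* c) ⟧ᶜ
          ≈⟨ ⊖-homo (a ℕ.* c ℕ.+ b ℕ.* d) (a ℕ.* d ℕ.+ b ℕ.* c) ⟩
        (a ℕ.* c ℕ.+ b ℕ.* d) · 1# - (a ℕ.* d ℕ.+ b ℕ.* c) · 1#
          ≈⟨ +-cong (sum-of-products a c b d) (-‿cong (sum-of-products a d b c)) ⟩
        (a · 1# * c · 1# + b · 1# * d · 1#) - (a · 1# * d · 1# + b · 1# * c · 1#)
          ≈⟨ [x-y][z-w] _ _ _ _ ⟨
        (a · 1# - b · 1#) * (c · 1# - d · 1#)
          ≈⟨ *-cong (⟦⟧ᶜ≈ a b) (⟦⟧ᶜ≈ c d) ⟨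
        ⟦ a , b ⟧ᶜ * ⟦ c , d ⟧ᶜ ∎
    ; -‿homo = λ (a , b) → begin
        ⟦ b , a ⟧ᶜ             ≈⟨ ⟦⟧ᶜ≈ b a ⟩
        b · 1# - a · 1#        ≈⟨ ⁻¹-anti-homo‿- _ _ ⟨
        - (a · 1# - b · 1#)    ≈⟨ -‿cong (⟦⟧ᶜ≈ a b) ⟨
        - ⟦ a , b ⟧ᶜ           ∎
    ; 0-homo = refl
    ; 1-homo = refl
    }
    where
    -- `S` receives `- y` and `- w` as atoms, and the ring laws clear the signs afterwards.
    [x-y][z-w] : ∀ x y z w → (x - y) * (z - w) ≈ (x * z + y * w) - (x * w + y * z)
    [x-y][z-w] x y z w = begin
      (x - y) * (z - w)
        ≈⟨ S.solve 4 (λ x y z w → (x S.:+ y) S.:* (z S.:+ w)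
             S.:= (x S.:* z S.:+ y S.:* w) S.:+ (x S.:* w S.:+ y S.:* z)) refl _ _ _ _ ⟩
      (x * z + - y * - w) + (x * - w + - y * z)
        ≈⟨ +-cong (+-congˡ (trans (sym (-‿distribˡ-* y (- w)))
             (trans (-‿cong (sym (-‿distribʳ-* y w))) (-‿involutive (y * w)))))
             (+-cong (sym (-‿distribʳ-* x w)) (sym (-‿distribˡ-* y z))) ⟩
      (x * z + y * w) + (- (x * w) - y * z)
        ≈⟨ +-congˡ (-‿+-comm (x * w) (y * z)) ⟩
      (x * z + y * w) - (x * w + y * z) ∎

    sum-of-products : ∀ a b c d → (a ℕ.* b ℕ.+ c ℕ.* d) · 1# ≈ a · 1# * b · 1# + c · 1# * d · 1#
    sum-of-products a b c d =
      trans (×-homo-+ 1# (a ℕ.* b) (c ℕ.* d)) (+-cong (×1-homo-* a b) (×1-homo-* c d))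

  _≟_ : WeaklyDecidable (Induced-equivalence morphism)
  x ≟ y with ≡-dec ℕ._≟_ ℕ._≟_ x y
  ... | yes ≡.refl = just refl
  ... | no _       = nothing

  open RingSolver coefficients target morphism _≟_ public
    using (Polynomial; con; solve; _:=_; _:+_; _:*_; _:-_)

  :0 : ∀ {n} → Polynomial n
  :0 = con (0 , 0)

  :1 : ∀ {n} → Polynomial n
  :1 = con (1 , 0)

-- Ordered field arithmetic.

module OrderedField (R : CompleteOrderedField) where
  open CompleteOrderedField R
  open DecTotalOrder decTotalOrder public
    using (≤-respˡ-≈; ≤-respʳ-≈; total; antisym; _≤?_)
    renaming (refl to ≤-refl; trans to ≤-trans; reflexive to ≤-reflexive)
  private module Strict = NonStrictToStrict _≈_ _≤_
  open IntegerCoefficients commutativeRing public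
  open GroupProperties +-group using (x∙y⁻¹≈ε⇒x≈y)

  <⇒≱ : ∀ {x y} → x < y → ¬ (y ≤ x)
  <⇒≱ = Strict.<⇒≱ antisym

  ≰⇒> : ∀ {x y} → ¬ (x ≤ y) → y < x
  ≰⇒> = Strict.≰⇒> sym ≤-reflexive total

  <-≤-trans : ∀ {x y z} → x < y → y ≤ z → x < z
  <-≤-trans = Strict.<-≤-trans sym ≤-trans antisym ≤-respʳ-≈

  ≤-<-trans : ∀ {x y z} → x ≤ y → y < z → x < z
  ≤-<-trans = Strict.≤-<-trans ≤-trans antisym ≤-respˡ-≈

  <-respʳ : ∀ {x y z} → y ≈ z → x < y → x < z
  <-respʳ = Strict.<-respʳ-≈ sym trans ≤-respʳ-≈

  x≤y⇒0≤y-x : ∀ {x y} → x ≤ y → 0# ≤ y - x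
  x≤y⇒0≤y-x {x} x≤y = ≤-respˡ-≈ (-‿inverseʳ x) (+-monoˡ-≤ (- x) x≤y)

  0≤y-x⇒x≤y : ∀ {x y} → 0# ≤ y - x → x ≤ y
  0≤y-x⇒x≤y {x} {y} 0≤y-x = ≤-respˡ-≈ (+-identityˡ x)
    (≤-respʳ-≈ (solve 2 (λ x y → y :- x :+ x := y) refl x y) (+-monoˡ-≤ x 0≤y-x))

  -- The shape of most inequality proofs below: exhibit y − x as a sum of
  -- nonnegative terms and leave the identity to the ring solver.
  ≤-by : ∀ {x y z} → 0# ≤ z → z ≈ y - x → x ≤ y
  ≤-by 0≤z z≈y-x = 0≤y-x⇒x≤y (≤-respʳ-≈ z≈y-x 0≤z)

  infixl 6 _⊞_
  _⊞_ : ∀ {x y} → 0# ≤ x → 0# ≤ y → 0# ≤ x + y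
  _⊞_ {x} {y} 0≤x 0≤y = ≤-trans 0≤y (≤-respˡ-≈ (+-identityˡ y) (+-monoˡ-≤ y 0≤x))

  infixl 7 _⊠_
  _⊠_ : ∀ {x y} → 0# ≤ x → 0# ≤ y → 0# ≤ x * y
  _⊠_ = *-nonneg

  +-mono-≤ : ∀ {x y z w} → x ≤ y → z ≤ w → x + z ≤ y + w
  +-mono-≤ {x} {y} {z} {w} x≤y z≤w = ≤-by (x≤y⇒0≤y-x x≤y ⊞ x≤y⇒0≤y-x z≤w)
    (solve 4 (λ x y z w → y :- x :+ (w :- z) := y :+ w :- (x :+ z)) refl x y z w)

  square-nonneg : ∀ x → 0# ≤ x * x
  square-nonneg x with total 0# x
  ... | inj₁ 0≤x = 0≤x ⊠ 0≤x
  ... | inj₂ x≤0 = ≤-respʳ-≈ (solve 1 (λ x → (:0 :- x) :* (:0 :- x) := x :* x) refl x)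
                     (x≤y⇒0≤y-x x≤0 ⊠ x≤y⇒0≤y-x x≤0)

  0≤1 : 0# ≤ 1#
  0≤1 = ≤-respʳ-≈ (*-identityˡ 1#) (square-nonneg 1#)

  0<1 : 0# < 1#
  0<1 = 0≤1 , 0≉1

  ≤-or-≥ : ∀ {x y} → (y ≤ x → x ≤ y) → x ≤ y
  ≤-or-≥ {x} {y} y≤x⇒x≤y with total x y
  ... | inj₁ x≤y = x≤y
  ... | inj₂ y≤x = y≤x⇒x≤y y≤x

  x<y⇒0<y-x : ∀ {x y} → x < y → 0# < y - x
  x<y⇒0<y-x (x≤y , x≉y) = x≤y⇒0≤y-x x≤y ,
    λ 0≈y-x → x≉y (sym (x∙y⁻¹≈ε⇒x≈y _ _ (sym 0≈y-x)))

  0<y-x⇒x<y : ∀ {x y} → 0# < y - x → x < y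
  0<y-x⇒x<y {x} {y} (0≤y-x , 0≉y-x) = 0≤y-x⇒x≤y 0≤y-x ,
    λ x≈y → 0≉y-x (sym (trans (+-congʳ (sym x≈y)) (-‿inverseʳ x)))

  +-pos : ∀ {x y} → 0# < x → 0# ≤ y → 0# < x + y
  +-pos {x} {y} 0<x 0≤y =
    <-≤-trans 0<x (≤-by 0≤y (solve 2 (λ x y → y := x :+ y :- x) refl x y))

  *-inverseˡ : ∀ {x} → 0# < x → x ⁻¹ * x ≈ 1#
  *-inverseˡ (_ , 0≉x) = trans (*-comm _ _) (*-inverseʳ _ (0≉x ∘ sym))

  *-pos : ∀ {x y} → 0# < x → 0# < y → 0# < x * y
  *-pos {x} {y} 0<x 0<y@(_ , 0≉y) = proj₁ 0<x ⊠ proj₁ 0<y , λ 0≈xy → 0≉y (begin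
    0#              ≈⟨ zeroʳ (x ⁻¹) ⟨
    x ⁻¹ * 0#       ≈⟨ *-congˡ 0≈xy ⟩
    x ⁻¹ * (x * y)  ≈⟨ *-assoc _ _ _ ⟨
    x ⁻¹ * x * y    ≈⟨ *-congʳ (*-inverseˡ 0<x) ⟩
    1# * y          ≈⟨ *-identityˡ y ⟩
    y               ∎)
    where open SetoidReasoning setoid

  -- Otherwise `x * (0# - x ⁻¹)` would be nonnegative, although it equals `0# - 1#`.
  ⁻¹-pos : ∀ {x} → 0# < x → 0# < x ⁻¹
  ⁻¹-pos {x} 0<x = ≰⇒> λ x⁻¹≤0 → <⇒≱ 0<1 (≤-by (proj₁ 0<x ⊠ x≤y⇒0≤y-x x⁻¹≤0)
    (trans (solve 2 (λ x i → x :* (:0 :- i) := :0 :- i :* x) refl x (x ⁻¹))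
      (+-congˡ (-‿cong (*-inverseˡ 0<x)))))

  halve-nonneg : ∀ {x} → 0# ≤ x + x → 0# ≤ x
  halve-nonneg {x} 0≤x+x with total 0# x
  ... | inj₁ 0≤x = 0≤x
  ... | inj₂ x≤0 = ≤-trans 0≤x+x
    (≤-by (x≤y⇒0≤y-x x≤0) (solve 1 (λ x → :0 :- x := x :- (x :+ x)) refl x))

  -- Together, ∣ x ∣ ≤ b; sums of nonnegative terms need no absolute value.
  record Bound (x : ℝ) : Set where
    field
      b     : ℝ
      0≤b   : 0# ≤ b
      0≤b-x : 0# ≤ b - x
      0≤b+x : 0# ≤ b + x

  bound : ∀ x → Bound x
  bound x with total 0# x
  ... | inj₁ 0≤x = record
    { b = x ; 0≤b = 0≤x
    ; 0≤b-x = ≤-respʳ-≈ (sym (-‿inverseʳ x)) ≤-refl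
    ; 0≤b+x = 0≤x ⊞ 0≤x }
  ... | inj₂ x≤0 = record
    { b = 0# - x ; 0≤b = 0≤-x
    ; 0≤b-x = ≤-respʳ-≈ (solve 1 (λ x → (:0 :- x) :+ (:0 :- x) := :0 :- x :- x) refl x) (0≤-x ⊞ 0≤-x)
    ; 0≤b+x = ≤-respʳ-≈ (solve 1 (λ x → :0 := :0 :- x :+ x) refl x) ≤-refl }
    where 0≤-x = x≤y⇒0≤y-x x≤0

  -- The two products (b + x) (c + y) and (b - x) (c - y) add up to twice the claimed quantity.
  *-bound : ∀ {x y b c} → 0# ≤ b + x → 0# ≤ b - x → 0# ≤ c + y → 0# ≤ c - y →
            0# ≤ b * c + x * y
  *-bound {x} {y} {b} {c} p q r s = halve-nonneg (≤-respʳ-≈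
    (solve 4 (λ x y b c → (b :+ x) :* (c :+ y) :+ (b :- x) :* (c :- y)
                       := b :* c :+ x :* y :+ (b :* c :+ x :* y)) refl x y b c)
    (p ⊠ r ⊞ q ⊠ s))

  -- Natural numbers in the field and the Archimedean property.

  fromℕ-nonneg : ∀ n → 0# ≤ fromℕ n
  fromℕ-nonneg zero    = ≤-refl
  fromℕ-nonneg (suc n) = 0≤1 ⊞ fromℕ-nonneg n

  fromℕ-mono : ∀ {m n} → m ℕ.≤ n → fromℕ m ≤ fromℕ n
  fromℕ-mono {n = n} ℕ.z≤n = fromℕ-nonneg n
  fromℕ-mono {suc m} {suc n} (ℕ.s≤s m≤n) = ≤-by (x≤y⇒0≤y-x (fromℕ-mono m≤n))
    (solve 2 (λ m n → n :- m := (:1 :+ n) :- (:1 :+ m)) refl (fromℕ m) (fromℕ n))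

  1≤fromℕ : ∀ {n} → 1 ℕ.≤ n → 1# ≤ fromℕ n
  1≤fromℕ 1≤n = ≤-trans (≤-reflexive (sym (+-identityʳ 1#))) (fromℕ-mono 1≤n)

  0<fromℕ : ∀ {n} → 1 ℕ.≤ n → 0# < fromℕ n
  0<fromℕ 1≤n = <-≤-trans 0<1 (1≤fromℕ 1≤n)

  -- If b were the least upper bound of the naturals, n + 1 ≤ b for all n would make b - 1 an upper
  -- bound too. Shifting by `N` extends the assumed bound to all n.
  archimedean : ∀ x N → ¬ (∀ n → N ℕ.≤ n → fromℕ n ≤ x)
  archimedean x N bounded =
    let b , upper , least = supremum (λ r → ∃ λ n → r ≈ fromℕ n) (0# , 0 , refl)
          (x , λ r (n , r≈n) → ≤-trans (≤-reflexive r≈n)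
             (≤-trans (fromℕ-mono (ℕ.m≤m+n n N)) (bounded (n ℕ.+ N) (ℕ.m≤n+m N n))))
        b≤b-1 = least (b - 1#) λ r (n , r≈n) → ≤-by
          (x≤y⇒0≤y-x (upper (fromℕ (suc n)) (suc n , refl)))
          (trans (solve 2 (λ b n → b :- (:1 :+ n) := b :- :1 :- n) refl b (fromℕ n))
            (+-congˡ (-‿cong (sym r≈n))))
    in <⇒≱ 0<1 (≤-by (x≤y⇒0≤y-x b≤b-1)
         (solve 1 (λ b → b :- :1 :- b := :0 :- :1) refl b))

  -- Tangent inequality for powers and for the exponential.

  ^-nonneg : ∀ {x} → 0# ≤ x → ∀ n → 0# ≤ x ^ n
  ^-nonneg 0≤x zero    = 0≤1
  ^-nonneg 0≤x (suc n) = 0≤x ⊠ ^-nonneg 0≤x n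

  -- The tangent inequality for z ↦ z ^ n, multiplied by u so that no power
  -- n − 1 occurs.
  ^-tangent : ∀ {u v} → 0# ≤ u → 0# ≤ v → ∀ n →
              0# ≤ u * v ^ n - u ^ n * (u + fromℕ n * (v - u))
  ^-tangent {u} {v} 0≤u 0≤v zero = ≤-reflexive
    (solve 2 (λ u v → :0 := u :* :1 :- :1 :* (u :+ :0 :* (v :- u))) refl u v)
  -- The defect for n + 1 is `v` times the defect for n plus a nonnegative multiple of (v - u)².
  ^-tangent {u} {v} 0≤u 0≤v (suc n) = ≤-respʳ-≈
    (solve 5 (λ u v p q n →
        v :* (u :* q :- p :* (u :+ n :* (v :- u))) :+ p :* (n :* ((v :- u) :* (v :- u)))
        := u :* (v :* q) :- u :* p :* (u :+ (:1 :+ n) :* (v :- u)))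
      refl u v (u ^ n) (v ^ n) (fromℕ n))
    (0≤v ⊠ ^-tangent 0≤u 0≤v n
      ⊞ ^-nonneg 0≤u n ⊠ (fromℕ-nonneg n ⊠ square-nonneg (v - u)))

  1+y/n-nonneg : ∀ {y n} → 0# < n → 0# ≤ n + y → 0# ≤ 1# + y * n ⁻¹
  1+y/n-nonneg {y} {n} 0<n 0≤n+y = ≤-respʳ-≈
    (trans (solve 3 (λ n y i → i :* (n :+ y) := i :* n :+ y :* i) refl n y (n ⁻¹))
      (+-congʳ (*-inverseˡ 0<n)))
    (proj₁ (⁻¹-pos 0<n) ⊠ 0≤n+y)

  n*[1+y/n] : ∀ {y n} → 0# < n → n * (1# + y * n ⁻¹) ≈ n + y
  n*[1+y/n] {y} {n} 0<n = begin
    n * (1# + y * n ⁻¹)   ≈⟨ solve 3 (λ n y i → n :* (:1 :+ y :* i) := n :+ y :* (i :* n)) refl n y (n ⁻¹) ⟩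
    n + y * (n ⁻¹ * n)    ≈⟨ +-congˡ (*-congˡ (*-inverseˡ 0<n)) ⟩
    n + y * 1#            ≈⟨ +-congˡ (*-identityʳ y) ⟩
    n + y                 ∎
    where open SetoidReasoning setoid

  -- `^-tangent` at 1 + w/n and 1 + y/n, multiplied by n to clear the inverses. Relative to n, the
  -- term w (q - p) vanishes in the limit, leaving the tangent inequality of the exponential.
  n*-tangent : ∀ {w y} n → 0# < fromℕ n → 0# ≤ fromℕ n + w → 0# ≤ fromℕ n + y →
    let p = (1# + w * fromℕ n ⁻¹) ^ n
        q = (1# + y * fromℕ n ⁻¹) ^ n
    in 0# ≤ fromℕ n * (q - p * (1# + (y - w))) + w * (q - p)
  n*-tangent {w} {y} n 0<n 0≤n+w 0≤n+y = ≤-respʳ-≈ (begin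
    ν * (u * q - p * (u + ν * (v - u)))
      ≈⟨ solve 5 (λ ν u v p q → ν :* (u :* q :- p :* (u :+ ν :* (v :- u)))
           := (ν :* u) :* q :- p :* (ν :* u :+ ν :* (ν :* v :- ν :* u))) refl ν u v p q ⟩
    ν * u * q - p * (ν * u + ν * (ν * v - ν * u))
      ≈⟨ +-cong (*-congʳ νu) (-‿cong (*-congˡ (+-cong νu (*-congˡ (+-cong νv (-‿cong νu)))))) ⟩
    (ν + w) * q - p * ((ν + w) + ν * ((ν + y) - (ν + w)))
      ≈⟨ solve 5 (λ ν w y p q → (ν :+ w) :* q :- p :* ((ν :+ w) :+ ν :* ((ν :+ y) :- (ν :+ w)))
           := ν :* (q :- p :* (:1 :+ (y :- w))) :+ w :* (q :- p)) refl ν w y p q ⟩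
    ν * (q - p * (1# + (y - w))) + w * (q - p) ∎)
    (proj₁ 0<n ⊠ ^-tangent (1+y/n-nonneg 0<n 0≤n+w) (1+y/n-nonneg 0<n 0≤n+y) n)
    where
    open SetoidReasoning setoid
    ν = fromℕ n
    u = 1# + w * ν ⁻¹
    v = 1# + y * ν ⁻¹
    p = u ^ n
    q = v ^ n
    νu = n*[1+y/n] {w} 0<n
    νv = n*[1+y/n] {y} 0<n

  -- This and the next three lemmas each extract one consequence of ν ≥ Z + A + B + 1, so that a
  -- single threshold serves all of them.
  large-1 : ∀ {ν Z A B} → 0# ≤ ν - (Z + A + B + 1#) →
            0# ≤ Z → 0# ≤ A → 0# ≤ B → 1# ≤ ν
  large-1 {ν} {Z} {A} {B} 0≤ν-X 0≤Z 0≤A 0≤B = ≤-by (0≤ν-X ⊞ 0≤Z ⊞ 0≤A ⊞ 0≤B)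
    (solve 4 (λ ν Z A B → ν :- (Z :+ A :+ B :+ :1) :+ Z :+ A :+ B := ν :- :1) refl ν Z A B)

  large-A : ∀ {ν Z A B w} → 0# ≤ ν - (Z + A + B + 1#) →
            0# ≤ Z → 0# ≤ A + w → 0# ≤ B → 0# ≤ ν + w
  large-A {ν} {Z} {A} {B} {w} 0≤ν-X 0≤Z 0≤A+w 0≤B = ≤-respʳ-≈
    (solve 5 (λ ν Z A B w → ν :- (Z :+ A :+ B :+ :1) :+ Z :+ (A :+ w) :+ B :+ :1 := ν :+ w)
      refl ν Z A B w)
    (0≤ν-X ⊞ 0≤Z ⊞ 0≤A+w ⊞ 0≤B ⊞ 0≤1)

  large-B : ∀ {ν Z A B y} → 0# ≤ ν - (Z + A + B + 1#) →
            0# ≤ Z → 0# ≤ A → 0# ≤ B + y → 0# ≤ ν + y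
  large-B {ν} {Z} {A} {B} {y} 0≤ν-X 0≤Z 0≤A 0≤B+y = ≤-respʳ-≈
    (solve 5 (λ ν Z A B y → ν :- (Z :+ A :+ B :+ :1) :+ Z :+ A :+ (B :+ y) :+ :1 := ν :+ y)
      refl ν Z A B y)
    (0≤ν-X ⊞ 0≤Z ⊞ 0≤A ⊞ 0≤B+y ⊞ 0≤1)

  large-* : ∀ {ν Y A B δ} → 0# ≤ ν - (Y * δ ⁻¹ + A + B + 1#) → 0# ≤ A + B → 0# < δ →
            0# ≤ ν * δ - Y - δ
  large-* {ν} {Y} {A} {B} {δ} 0≤ν-X 0≤A+B 0<δ = ≤-respʳ-≈
    (trans (solve 6 (λ ν Y A B δ i → δ :* (ν :- (Y :* i :+ A :+ B :+ :1)) :+ δ :* (A :+ B)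
                        := ν :* δ :- Y :* (i :* δ) :- δ) refl ν Y A B δ (δ ⁻¹))
      (+-congʳ (+-congˡ (-‿cong (trans (*-congˡ (*-inverseˡ 0<δ)) (*-identityʳ Y))))))
    (proj₁ 0<δ ⊠ 0≤ν-X ⊞ proj₁ 0<δ ⊠ 0≤A+B)

  -- With p near m and q near a, an inequality growing with ν contradicts
  -- the gap δ (2 + E) between m c and a.
  gap-estimate : ∀ {ν w p q a m c δ A E M} →
    0# ≤ ν → 0# ≤ p → 0# ≤ q →
    0# ≤ A → 0# ≤ A + w → 0# ≤ A - w → 0# ≤ E + c → 0# ≤ E - c → 0# ≤ M - (a + m) →
    m - δ < p → p < m + δ → q < a + δ →
    δ * (1# + 1# + E) ≈ m * c - a →
    0# ≤ ν * (q - p * c) + w * (q - p) →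
    0# ≤ ν * δ - A * (M + (δ + δ)) - δ →
    δ ≤ 0#
  gap-estimate {ν} {w} {p} {q} {a} {m} {c} {δ} {A} {E} {M}
    0≤ν 0≤p 0≤q 0≤A 0≤A+w 0≤A-w 0≤E+c 0≤E-c 0≤M-s
    m-δ<p p<m+δ q<a+δ gap tangent ν-large = ≤-by
      -- With Y = A (M + 2δ), the first three terms give ν δ ≤ Y, while `ν-large` says ν δ ≥ Y + δ.
      (tangent ⊞ 0≤ν ⊠ x≤y⇒0≤y-x q-pc≤-δ ⊞ x≤y⇒0≤y-x w[q-p]≤Y ⊞ ν-large)
      (solve 5 (λ ν s z δ Y → ν :* s :+ z :+ ν :* (:0 :- δ :- s) :+ (Y :- z) :+ (ν :* δ :- Y :- δ)
                           := :0 :- δ) refl ν (q - p * c) (w * (q - p)) δ (A * (M + (δ + δ))))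
    where
    0≤a+δ-q : 0# ≤ a + δ - q
    0≤a+δ-q = x≤y⇒0≤y-x (proj₁ q<a+δ)
    0≤m+δ-p : 0# ≤ m + δ - p
    0≤m+δ-p = x≤y⇒0≤y-x (proj₁ p<m+δ)
    0≤δE+[p-m]c : 0# ≤ δ * E + (p - m) * c
    0≤δE+[p-m]c = *-bound
      (≤-respʳ-≈ (solve 3 (λ p m δ → p :- (m :- δ) := δ :+ (p :- m)) refl p m δ)
        (x≤y⇒0≤y-x (proj₁ m-δ<p)))
      (≤-respʳ-≈ (solve 3 (λ p m δ → m :+ δ :- p := δ :- (p :- m)) refl p m δ) 0≤m+δ-p)
      0≤E+c 0≤E-c
    p+q-bound : 0# ≤ M + (δ + δ) - (p + q)
    p+q-bound = ≤-respʳ-≈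
      (solve 6 (λ q p a m δ M → a :+ δ :- q :+ (m :+ δ :- p) :+ (M :- (a :+ m))
                             := M :+ (δ :+ δ) :- (p :+ q)) refl q p a m δ M)
      (0≤a+δ-q ⊞ 0≤m+δ-p ⊞ 0≤M-s)
    -- p (A + w) + q (A - w) ≥ 0 amounts to w (q - p) ≤ A (p + q).
    w[q-p]≤Y : w * (q - p) ≤ A * (M + (δ + δ))
    w[q-p]≤Y = ≤-by (0≤p ⊠ 0≤A+w ⊞ 0≤q ⊠ 0≤A-w ⊞ 0≤A ⊠ p+q-bound)
      (solve 5 (λ p q w A U → p :* (A :+ w) :+ q :* (A :- w) :+ A :* (U :- (p :+ q))
                           := A :* U :- w :* (q :- p)) refl p q w A (M + (δ + δ)))
    -- Of the gap δ (2 + E), one δ pays for replacing q by a and δ E for replacing p by m; one δ is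
    -- left over.
    q-pc≤-δ : q - p * c ≤ 0# - δ
    q-pc≤-δ = ≤-by (0≤a+δ-q ⊞ 0≤δE+[p-m]c)
      (trans (solve 7 (λ q p c a m δ E → a :+ δ :- q :+ (δ :* E :+ (p :- m) :* c)
                 := δ :* (:1 :+ :1 :+ E) :- (m :* c :- a) :+ (:0 :- δ :- (q :- p :* c)))
               refl q p c a m δ E)
        (trans (+-congʳ (trans (+-congʳ gap) (-‿inverseʳ (m * c - a)))) (+-identityˡ _)))

  -- For n ≥ `N₁ + N₂` both powers are within δ of their limits. If also n ≥ `X`, `gap-estimate`
  -- yields δ ≤ 0; so all such n lie below `X`, against the Archimedean property.
  exp-tangent-gap : ∀ {w y a m} → a < m * (1# + (y - w)) → IsExp y a → ¬ IsExp w m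
  exp-tangent-gap {w} {y} {a} {m} a<mc y→a w→m = archimedean X (N₁ ℕ.+ N₂) fromℕ≤X
    where
    open Bound (bound w)
      using () renaming (b to A; 0≤b to 0≤A; 0≤b-x to 0≤A-w; 0≤b+x to 0≤A+w)
    open Bound (bound y)
      using () renaming (b to B; 0≤b to 0≤B; 0≤b+x to 0≤B+y)
    open Bound (bound (1# + (y - w)))
      using () renaming (b to E; 0≤b to 0≤E; 0≤b-x to 0≤E-c; 0≤b+x to 0≤E+c)
    open Bound (bound (a + m))
      using () renaming (b to M; 0≤b to 0≤M; 0≤b-x to 0≤M-s)
    D gap δ Y X : ℝ
    D = 1# + 1# + E
    gap = m * (1# + (y - w)) - a
    -- Makes the gap exactly δ (2 + E), as `gap-estimate` expects.
    δ = gap * D ⁻¹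
    Y = A * (M + (δ + δ))
    -- In order, the summands make ν δ outgrow the error `Y`, keep ν + w and ν + y nonnegative, and
    -- make ν positive.
    X = Y * δ ⁻¹ + A + B + 1#
    0<D : 0# < D
    0<D = +-pos (+-pos 0<1 0≤1) 0≤E
    0<δ : 0# < δ
    0<δ = *-pos (x<y⇒0<y-x a<mc) (⁻¹-pos 0<D)
    δD≈gap : δ * D ≈ gap
    δD≈gap = trans (*-assoc _ _ _) (trans (*-congˡ (*-inverseˡ 0<D)) (*-identityʳ _))
    0≤Y/δ : 0# ≤ Y * δ ⁻¹
    0≤Y/δ = 0≤A ⊠ (0≤M ⊞ (proj₁ 0<δ ⊞ proj₁ 0<δ)) ⊠ proj₁ (⁻¹-pos 0<δ)
    N₁ N₂ : ℕ
    N₁ = proj₁ (y→a δ 0<δ)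
    N₂ = proj₁ (w→m δ 0<δ)
    δ≤0 : ∀ n → N₁ ℕ.+ N₂ ℕ.≤ n → X ≤ fromℕ n → δ ≤ 0#
    δ≤0 n N≤n X≤n = gap-estimate (proj₁ 0<ν)
      (^-nonneg (1+y/n-nonneg 0<ν 0≤ν+w) n) (^-nonneg (1+y/n-nonneg 0<ν 0≤ν+y) n)
      0≤A 0≤A+w 0≤A-w 0≤E+c 0≤E-c 0≤M-s
      (proj₁ p-near) (proj₂ p-near) (proj₂ q-near) δD≈gap (n*-tangent n 0<ν 0≤ν+w 0≤ν+y)
      (large-* 0≤ν-X (0≤A ⊞ 0≤B) 0<δ)
      where
      0≤ν-X : 0# ≤ fromℕ n - X
      0≤ν-X = x≤y⇒0≤y-x X≤n
      0<ν : 0# < fromℕ n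
      0<ν = <-≤-trans 0<1 (large-1 0≤ν-X 0≤Y/δ 0≤A 0≤B)
      0≤ν+w : 0# ≤ fromℕ n + w
      0≤ν+w = large-A 0≤ν-X 0≤Y/δ 0≤A+w 0≤B
      0≤ν+y : 0# ≤ fromℕ n + y
      0≤ν+y = large-B 0≤ν-X 0≤Y/δ 0≤A 0≤B+y
      q-near = proj₂ (y→a δ 0<δ) n (ℕ.≤-trans (ℕ.m≤m+n N₁ N₂) N≤n)
      p-near = proj₂ (w→m δ 0<δ) n (ℕ.≤-trans (ℕ.m≤n+m N₂ N₁) N≤n)
    fromℕ≤X : ∀ n → N₁ ℕ.+ N₂ ℕ.≤ n → fromℕ n ≤ X
    fromℕ≤X n N≤n = ≤-or-≥ λ X≤n → contradiction (δ≤0 n N≤n X≤n) (<⇒≱ 0<δ)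

  exp-tangent : ∀ {w y a m} → IsExp y a → IsExp w m → m * (1# + (y - w)) ≤ a
  exp-tangent {w} {y} {a} {m} y→a w→m =
    decidable-stable (m * (1# + (y - w)) ≤? a) λ mc≰a → exp-tangent-gap (≰⇒> mc≰a) y→a w→m

-- Counting lists without repetition.

-- Pigeonhole by deletion: the head of `xs` is cut out of `ys` where its membership proof locates
-- it, and uniqueness ensures that the tail still embeds.
Unique-length-≤ : ∀ {A : Set} {xs ys : List A} → Unique xs → (∀ {z} → z ∈ xs → z ∈ ys) →
                  length xs ℕ.≤ length ys
Unique-length-≤ [] _ = ℕ.z≤n
Unique-length-≤ {A} {x ∷ xs} (x∉xs ∷ unique) xs⊆ys with ∈-∃++ (xs⊆ys (here ≡.refl))
... | as , bs , ≡.refl =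
  ≡.subst (suc (length xs) ℕ.≤_) (≡.sym (List.length-++-sucʳ as x bs))
    (ℕ.s≤s (Unique-length-≤ unique remaining))
  where
  remaining : ∀ {z} → z ∈ xs → z ∈ as ++ bs
  remaining z∈xs with ∈-++⁻ as (xs⊆ys (there z∈xs))
  ... | inj₁ z∈as           = ∈-++⁺ˡ z∈as
  ... | inj₂ (there z∈bs)   = ∈-++⁺ʳ as z∈bs
  ... | inj₂ (here ≡.refl)  = contradiction ≡.refl (All.lookup x∉xs z∈xs)

-- The natural logarithm.

module Logarithm
  (R : CompleteOrderedField)
  (ln : CompleteOrderedField.ℝ R → CompleteOrderedField.ℝ R)
  (isNaturalLog : CompleteOrderedField.IsNaturalLog R ln)
  where
  open CompleteOrderedField R
  open OrderedField R

  1^n≈1 : ∀ {x} → x ≈ 1# → ∀ n → x ^ n ≈ 1#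
  1^n≈1 x≈1 zero    = refl
  1^n≈1 x≈1 (suc n) = trans (*-cong x≈1 (1^n≈1 x≈1 n)) (*-identityˡ 1#)

  -- Every term of the sequence is 1, also at n = 0, where the unspecified inverse is multiplied by
  -- zero.
  exp-0 : IsExp 0# 1#
  exp-0 δ 0<δ = 0 , λ n _ →
    let 1^n = sym (1^n≈1 (trans (+-congˡ (zeroˡ _)) (+-identityʳ 1#)) n) in
      <-respʳ 1^n (0<y-x⇒x<y (<-respʳ (solve 1 (λ δ → δ := :1 :- (:1 :- δ)) refl δ) 0<δ))
    , ≤-<-trans (≤-reflexive (sym 1^n))
        (0<y-x⇒x<y (<-respʳ (solve 1 (λ δ → δ := :1 :+ δ :- :1) refl δ) 0<δ))

  ln-tangent : ∀ {a m} → 0# < a → 0# < m → ln a ≤ ln m + (a * m ⁻¹ - 1#)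
  ln-tangent {a} {m} 0<a 0<m = ≤-by
    (proj₁ (⁻¹-pos 0<m) ⊠ x≤y⇒0≤y-x (exp-tangent (isNaturalLog a 0<a) (isNaturalLog m 0<m)))
    (trans (solve 5 (λ i a m y w → i :* (a :- m :* (:1 :+ (y :- w)))
                      := a :* i :- (i :* m) :* (:1 :+ (y :- w))) refl (m ⁻¹) a m (ln a) (ln m))
      (trans (+-congˡ (-‿cong (trans (*-congʳ (*-inverseˡ 0<m)) (*-identityˡ _))))
        (solve 3 (λ s y w → s :- (:1 :+ (y :- w)) := w :+ (s :- :1) :- y) refl (a * m ⁻¹) (ln a) (ln m))))

  -- `exp-tangent` with w = ln a and y = 0 reads a (1 - ln a) ≤ 1, hence a ln a ≥ a - 1 ≥ 0.
  ln-nonneg : ∀ {a} → 1# ≤ a → 0# ≤ ln a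
  ln-nonneg {a} 1≤a = ≤-respʳ-≈
    (trans (sym (*-assoc _ _ _)) (trans (*-congʳ (*-inverseˡ 0<a)) (*-identityˡ _)))
    (proj₁ (⁻¹-pos 0<a) ⊠ 0≤a*ln)
    where
    0<a = <-≤-trans 0<1 1≤a
    0≤a*ln : 0# ≤ a * ln a
    0≤a*ln = ≤-respʳ-≈
      (solve 2 (λ a l → a :- :1 :+ (:1 :- a :* (:1 :+ (:0 :- l))) := a :* l) refl a (ln a))
      (x≤y⇒0≤y-x 1≤a ⊞ x≤y⇒0≤y-x (exp-tangent exp-0 (isNaturalLog a 0<a)))

-- Impact vectors, paths and distances.

module PathProperties (R : CompleteOrderedField) (I : cLPI.Instance R) where
  open CompleteOrderedField R hiding (zero)
  open OrderedField R
  open cLPI R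
  open Paths I
  open DecMembership (Fin._≟_ {∣V∣}) using (_∈?_)
  open Min (DecTotalOrder.totalOrder decTotalOrder)
    using (⊓-glb; ⊓-mono-≤; x≤y⇒y⊓x≈x)

  infix 4 _≼_
  _≼_ : Impact → Impact → Set
  x ≼ y = ∀ v → value (x v) ≤ value (y v)

  0≼ : ∀ x → 0ᵛ ≼ x
  0≼ x v = nonneg (x v)

  x≼x⊕y : ∀ x y → x ≼ x ⊕ y
  x≼x⊕y x y v = ≤-by (nonneg (y v)) (solve 2 (λ a b → b := a :+ b :- a) refl _ _)

  y≼x⊕y : ∀ x y → y ≼ x ⊕ y
  y≼x⊕y x y v = ≤-by (nonneg (x v)) (solve 2 (λ a b → a := a :+ b :- b) refl _ _)

  weight-mono : ∀ {x y} → x ≼ y → ∀ p → weight x p ≤ weight y p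
  weight-mono x≼y []      = ≤-refl
  weight-mono x≼y (v ∷ p) = +-mono-≤ (f-mono v (x≼y v)) (weight-mono x≼y p)

  weight-nonneg : ∀ x p → 0# ≤ weight x p
  weight-nonneg x []      = ≤-refl
  weight-nonneg x (v ∷ p) = nonneg (f v (x v)) ⊞ weight-nonneg x p

  d-mono : ∀ {x y} → x ≼ y → ∀ p → d x p ≤ d y p
  d-mono x≼y p = ⊓-mono-≤ (weight-mono x≼y p) ≤-refl

  d-mono-weight : ∀ x p q → weight x p ≤ weight x q → d x p ≤ d x q
  d-mono-weight _ _ _ w≤w′ = ⊓-mono-≤ w≤w′ ≤-refl

  -- Supplies the weight condition of feasibility: if the weight at zero reached T, monotonicity
  -- would keep the truncated length at T for every `x`.
  weight<T : ∀ x p → d x p < T → weight 0ᵛ p < T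
  weight<T x p d<T = ≰⇒> λ T≤w → <⇒≱ d<T (⊓-glb (≤-trans T≤w (weight-mono (0≼ x) p)) ≤-refl)

  suffix : ∀ x {u w v q} → u ∈ q → IsSimplePath w v q →
           ∃ λ q′ → IsSimplePath u v q′ × weight x q′ ≤ weight x q
  suffix x {q = q} (here ≡.refl) ((_ , last≡ , linked) , unique) =
    q , ((≡.refl , last≡ , linked) , unique) , ≤-refl
  suffix x {q = a ∷ b ∷ q} (there u∈q) ((_ , last≡ , _ ∷ linked) , _ ∷ unique)
    with suffix x u∈q ((≡.refl , last≡ , linked) , unique)
  ... | q′ , simple , q′≤q = q′ , simple ,
    ≤-trans q′≤q (≤-by (nonneg (f a (x a))) (solve 2 (λ a b → a := a :+ b :- b) refl _ _))

  -- Distances range over all paths, whereas the algorithm lists simple ones. Working from the end,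
  -- a start node met again is replaced by the suffix from its later occurrence, which is no heavier
  -- since node weights are nonnegative.
  remove-loops : ∀ x {u v} p → IsPath u v p →
                 ∃ λ q → IsSimplePath u v q × weight x q ≤ weight x p
  remove-loops x (u ∷ []) path = u ∷ [] , (path , [] ∷ []) , ≤-refl
  remove-loops x (u ∷ w ∷ p) (≡.refl , last≡ , u⟶w ∷ linked)
    with remove-loops x (w ∷ p) (≡.refl , last≡ , linked)
  ... | w ∷ q , simple@((≡.refl , last≡′ , linked′) , unique) , q≤p with u ∈? (w ∷ q)
  ...   | no  u∉q = u ∷ w ∷ q , ((≡.refl , last≡′ , u⟶w ∷ linked′) , ¬Any⇒All¬ _ u∉q ∷ unique) ,
                    +-mono-≤ ≤-refl q≤p
  ...   | yes u∈q with suffix x u∈q simple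
  ...     | q′ , simple′ , q′≤q = q′ , simple′ , ≤-trans q′≤q (≤-trans q≤p
              (≤-by (nonneg (f u (x u))) (solve 2 (λ a b → a := a :+ b :- b) refl _ _)))

  ‖⊕‖ : ∀ x y → ‖ x ⊕ y ‖ ≈ ‖ x ‖ + ‖ y ‖
  ‖⊕‖ x y = Sum.∑-distrib-+ +-commutativeMonoid (value ∘ x) (value ∘ y)

  ‖0‖ : ‖ 0ᵛ ‖ ≈ 0#
  ‖0‖ = Sum.sum-replicate-zero +-commutativeMonoid ∣V∣

  sum-nonneg : ∀ {n} (g : Fin n → ℝ) → (∀ i → 0# ≤ g i) → 0# ≤ sum g
  sum-nonneg {zero}  g 0≤g = ≤-refl
  sum-nonneg {suc n} g 0≤g = 0≤g zero ⊞ sum-nonneg (g ∘ suc) (0≤g ∘ suc)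

  ‖‖-nonneg : ∀ x → 0# ≤ ‖ x ‖
  ‖‖-nonneg x = sum-nonneg (value ∘ x) (nonneg ∘ x)

  solution-blocks : ∀ {x s t p} → IsSolution x → S s t → IsPath s t p → T ≤ d x p
  solution-blocks {s = s} {t} {p} solution s∈S path with solution s t s∈S
  ... | r , inj₁ (_ , minimal) , T≤r = ≤-trans T≤r (minimal p path)
  ... | r , inj₂ (none , _) , _ = contradiction path (none p)

  -- For T ≤ 0 every path has truncated length T, so distances do not
  -- depend on the impact vector.
  module _ (T≤0 : T ≤ 0#) where
    d≈T : ∀ x p → d x p ≈ T
    d≈T x p = x≤y⇒y⊓x≈x (≤-trans T≤0 (weight-nonneg x p))

    distance-constant : ∀ {x y s t r} → IsDistance x s t r → IsDistance y s t r
    distance-constant {x} {y} (inj₁ ((p , path , d≈r) , minimal)) =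
      inj₁ ( (p , path , trans (d≈T y p) (trans (sym (d≈T x p)) d≈r))
           , λ q path′ → ≤-respʳ-≈ (trans (d≈T x q) (sym (d≈T y q))) (minimal q path′))
    distance-constant (inj₂ none) = inj₂ none

-- Analysis of the algorithm.

module IncrementalInterdiction
  (R : CompleteOrderedField)
  (ln : CompleteOrderedField.ℝ R → CompleteOrderedField.ℝ R)
  (isNaturalLog : CompleteOrderedField.IsNaturalLog R ln)
  where
  open CompleteOrderedField R hiding (zero)
  open cLPI R
  open OrderedField R
  open Logarithm R ln isNaturalLog
  open Mult semiring using (×-homo-+)

  module Guarantee
    (C : ℝ) (0<C : 0# < C)
    (I : Instance)
    (ε : ℝ) (0<ε : 0# < ε) (ε<1 : ε < 1#)
    (oracle : Paths.Algorithm.Oracle I ln ε)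
    (isTBOracle : Paths.Algorithm.IsTBOracle I ln ε C oracle)
    (k : ℕ) (k≢0 : NonZero k)
    (x* : Paths.Impact I) (solution : Paths.IsSolution I x*)
    where
    open Paths I
    open Algorithm ln ε
    open PathProperties R I
    open DecMembership (List.≡-dec (Fin._≟_ {∣V∣})) using (_∈?_)

    0<ε⁻¹ : 0# < ε ⁻¹
    0<ε⁻¹ = ⁻¹-pos 0<ε

    1≤ε⁻¹ : 1# ≤ ε ⁻¹
    1≤ε⁻¹ = ≤-by (proj₁ 0<ε⁻¹ ⊠ x≤y⇒0≤y-x (proj₁ ε<1))
      (trans (solve 2 (λ e i → i :* (:1 :- e) := i :- i :* e) refl ε (ε ⁻¹))
        (+-congˡ (-‿cong (*-inverseˡ 0<ε))))

    -- Keeps the logarithm in the oracle's guarantee nonnegative, so that ‖s*‖ may be replaced by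
    -- the larger ‖x*‖.
    1≤n/ε : ∀ {n} → 1 ℕ.≤ n → 1# ≤ fromℕ n * ε ⁻¹
    1≤n/ε {n} 1≤n = ≤-trans 1≤ε⁻¹ (≤-by (proj₁ 0<ε⁻¹ ⊠ x≤y⇒0≤y-x (1≤fromℕ 1≤n))
      (solve 2 (λ n i → i :* (n :- :1) := n :* i :- i) refl (fromℕ n) (ε ⁻¹)))

    -- For T ≤ 0 a loop once entered never stops, so an output after at least one iteration forces T
    -- > 0.
    continue-constant : T ≤ 0# → ∀ {x y} → Continue x → Continue y
    continue-constant T≤0 (s , t , s∈S , r , distance , r<T⁻) =
      s , t , s∈S , r , distance-constant T≤0 distance , r<T⁻

    -- The arithmetic of one iteration: N is ‖x*‖, τ and κ count earlier iterations and paths, π is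
    -- the size of the new set, l = ln m, e = 1/ε, i = 1/m, X and σ are the norms of the current
    -- vector and the increment, and L = ln (π/ε).
    step-estimate : ∀ {N τ l π κ e i X σ σ* L} →
      X ≤ N * (C * (τ * (l - 1#) + κ * e * i)) →
      σ ≤ C * L * σ* → 0# ≤ L → L ≤ l + (π * e * i - 1#) → σ* ≤ N → 0# ≤ N →
      X + σ ≤ N * (C * ((1# + τ) * (l - 1#) + (π + κ) * e * i))
    step-estimate {N} {τ} {l} {π} {κ} {e} {i} {X} {σ} {σ*} {L} X≤ σ≤ 0≤L L≤ σ*≤N 0≤N =
      ≤-trans (+-mono-≤ X≤ (≤-trans σ≤ CLσ*≤))
        (≤-reflexive (solve 8 (λ N C τ l π κ e i →
            N :* (C :* (τ :* (l :- :1) :+ κ :* e :* i)) :+ C :* (l :+ (π :* e :* i :- :1)) :* N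
            := N :* (C :* ((:1 :+ τ) :* (l :- :1) :+ (π :+ κ) :* e :* i)))
          refl N C τ l π κ e i))
      where
      CLσ*≤ : C * L * σ* ≤ C * (l + (π * e * i - 1#)) * N
      CLσ*≤ = ≤-by (proj₁ 0<C ⊠ 0≤L ⊠ x≤y⇒0≤y-x σ*≤N ⊞ proj₁ 0<C ⊠ x≤y⇒0≤y-x L≤ ⊠ 0≤N)
        (solve 5 (λ C L M σ* N → C :* L :* (N :- σ*) :+ C :* (M :- L) :* N := C :* M :* N :- C :* L :* σ*)
          refl C L (l + (π * e * i - 1#)) σ* N)

    module _ (0<T : 0# < T) where
      T⁻<T : T⁻ < T
      T⁻<T = 0<y-x⇒x<y (<-respʳ
        (solve 2 (λ T ε → T :* ε := T :- T :* (:1 :- ε)) refl T ε) (*-pos 0<T 0<ε))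

      unblocked⇒<T : ∀ x p → ¬ (T⁻ ≤ d x p) → d x p < T
      unblocked⇒<T _ _ T⁻≰d = ≤-<-trans (proj₁ (≰⇒> T⁻≰d)) T⁻<T

      -- Every iteration makes progress. A path attaining the distance yields a simple unblocked
      -- `q`; if `q` is missing from `K`, then `K` has k > 0 entries, each at most as long as `q`.
      shortest-unblocked : ∀ {x s t r K} → IsDistance x s t r → r < T⁻ →
        AreShortestSimplePaths k x s t K → ∃ λ p → p ∈ K × ¬ (T⁻ ≤ d x p)
      -- Without any path the distance is T, which exceeds `T⁻`.
      shortest-unblocked (inj₂ (_ , r≈T)) r<T⁻ _ =
        contradiction (proj₁ T⁻<T) (<⇒≱ (≤-<-trans (≤-reflexive (sym r≈T)) r<T⁻))
      shortest-unblocked {x} {K = K} (inj₁ ((p , path , d≈r) , _)) r<T⁻ (_ , _ , _ , full , shortest)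
        with remove-loops x p path
      ... | q , simple , q≤p = from-K full
        where
        q-unblocked : ¬ (T⁻ ≤ d x q)
        q-unblocked = <⇒≱ (≤-<-trans (≤-trans (d-mono-weight x q p q≤p) (≤-reflexive d≈r)) r<T⁻)

        first : ∀ {K′} → K′ ≡ K → length K′ ≡ k → ∃ λ p → p ∈ K × ¬ (T⁻ ≤ d x p)
        first {[]}     _       0≡k = contradiction (≡.sym 0≡k) (ℕ.≢-nonZero⁻¹ k {{k≢0}})
        first {p′ ∷ _} ≡.refl _ with q ∈? K
        ... | yes q∈K = q , q∈K , q-unblocked
        ... | no  q∉K = p′ , here ≡.refl ,
          λ T⁻≤p′ → q-unblocked (≤-trans T⁻≤p′ (shortest p′ q (here ≡.refl) simple q∉K))

        from-K : _ → ∃ λ p → p ∈ K × ¬ (T⁻ ≤ d x p)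
        from-K (inj₁ ∣K∣≡k) = first ≡.refl ∣K∣≡k
        from-K (inj₂ all)   = q , all q simple , q-unblocked

      module Iteration {x P} (continue : Continue x) (collects : Collects k x P) where
        private
          K = proj₁ collects
          shortest = proj₁ (proj₂ collects)
          member = λ p → proj₂ (proj₂ (proj₂ collects)) p

        unique : Unique P
        unique = proj₁ (proj₂ (proj₂ collects))

        unblocked : ∀ {p} → p ∈ P → ¬ (T⁻ ≤ d x p)
        unblocked {p} p∈P with Equivalence.to (member p) p∈P
        ... | _ , _ , _ , _ , _ , T⁻≰d = T⁻≰d

        simple : ∀ {p} → p ∈ P → ∃₂ λ s t → S s t × IsSimplePath s t p
        simple {p} p∈P with Equivalence.to (member p) p∈P
        ... | s , t , s∈S , below , p∈K , _ =
          s , t , s∈S , All.lookup (proj₁ (proj₂ (shortest s t s∈S below))) p∈K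

        feasible : All IsFeasiblePath P
        feasible = All.tabulate λ {p} p∈P →
          simple p∈P , weight<T x p (unblocked⇒<T x p (unblocked p∈P))

        inhabited : ∃ λ p → p ∈ P
        inhabited =
          let s , t , s∈S , r , distance , r<T⁻ = continue
              below = r , distance , r<T⁻
              p , p∈K , T⁻≰d = shortest-unblocked distance r<T⁻ (shortest s t s∈S below)
          in p , Equivalence.from (member p) (s , t , s∈S , below , p∈K , T⁻≰d)

        -- Adding `x*` to the current vector can only lengthen paths further, so `x*` competes with
        -- the minimal blocking vector `s*`.
        x*-blocks : Blocks x P x*
        x*-blocks = All.tabulate λ {p} p∈P →
          let _ , _ , s∈S , path , _ = simple p∈P
          in ≤-trans (solution-blocks {x*} solution s∈S path) (d-mono (y≼x⊕y x x*) p)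

        1≤∣P∣ : 1 ℕ.≤ length P
        1≤∣P∣ = ∈⇒1≤length (proj₂ inhabited)
          where
          ∈⇒1≤length : ∀ {A : Set} {z : A} {zs} → z ∈ zs → 1 ℕ.≤ length zs
          ∈⇒1≤length {zs = _ ∷ _} _ = ℕ.s≤s ℕ.z≤n

        guarantee = isTBOracle P x (λ { ≡.refl → contradiction 1≤∣P∣ λ () }) unique feasible

        blocked : All (λ p → T⁻ ≤ d (x ⊕ oracle P x) p) P
        blocked = proj₁ guarantee

        norm-estimate : ∀ {τ κ m} → 0# < m →
          ‖ x ‖ ≤ ‖ x* ‖ * (C * (τ * (ln m - 1#) + κ * ε ⁻¹ * m ⁻¹)) →
          ‖ x ⊕ oracle P x ‖ ≤
            ‖ x* ‖ * (C * ((1# + τ) * (ln m - 1#) + (fromℕ (length P) + κ) * ε ⁻¹ * m ⁻¹))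
        norm-estimate {m = m} 0<m ‖x‖≤ =
          let s* , (_ , minimal) , ‖s‖≤ = proj₂ guarantee
          in ≤-trans (≤-reflexive (‖⊕‖ x (oracle P x)))
            (step-estimate ‖x‖≤ ‖s‖≤ (ln-nonneg (1≤n/ε 1≤∣P∣))
              (ln-tangent (<-≤-trans 0<1 (1≤n/ε 1≤∣P∣)) 0<m)
              (minimal x* x*-blocks) (‖‖-nonneg x*))

      -- paths collects the disjoint sets passed to the oracle.  Bounding each
      -- logarithm by the tangent of ln at a common m replaces the concavity
      -- argument; m is fixed only once the total number of paths is known.
      record Invariant (t : ℕ) (x : Impact) : Set where
        field
          paths    : List Path
          unique   : Unique paths
          feasible : All IsFeasiblePath paths
          blocked  : All (λ p → T⁻ ≤ d x p) paths
          t≤∣paths∣ : t ℕ.≤ length paths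
          bounded  : ∀ m → 0# < m →
            ‖ x ‖ ≤ ‖ x* ‖ * (C * (fromℕ t * (ln m - 1#) + fromℕ (length paths) * ε ⁻¹ * m ⁻¹))

      invariant : ∀ {t x} → Reaches k oracle t x → Invariant t x
      invariant start = record
        { paths = [] ; unique = [] ; feasible = [] ; blocked = [] ; t≤∣paths∣ = ℕ.z≤n
        ; bounded = λ m _ → ≤-reflexive (trans ‖0‖
            (solve 5 (λ N C l e i → :0 := N :* (C :* (:0 :* (l :- :1) :+ :0 :* e :* i))) refl
              (‖ x* ‖) C (ln m) (ε ⁻¹) (m ⁻¹)))
        }
      invariant (step {t} {x} {P} reaches continue collects) = record
        { paths     = P ++ Q.paths
        ; unique    = Unique-++⁺ It.unique Q.unique
            -- The new paths are unblocked at `x` and the earlier ones blocked there, so the sets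
            -- are disjoint.
            λ (p∈P , p∈Q) → It.unblocked p∈P (All.lookup Q.blocked p∈Q)
        ; feasible  = All-++⁺ It.feasible Q.feasible
        ; blocked   = All-++⁺ It.blocked
            (All.map (λ {p} T⁻≤d → ≤-trans T⁻≤d (d-mono (x≼x⊕y x (oracle P x)) p)) Q.blocked)
        ; t≤∣paths∣ = ≡.subst (suc t ℕ.≤_) (≡.sym (List.length-++ P))
          -- Each iteration contributes at least one path.
          (ℕ.+-mono-≤ It.1≤∣P∣ Q.t≤∣paths∣)
        ; bounded   = λ m 0<m → ≤-trans (It.norm-estimate 0<m (Q.bounded m 0<m))
            (≤-reflexive (*-congˡ (*-congˡ (+-congˡ (*-congʳ (*-congʳ (sym ∣P++Q∣)))))))
        }
        where
        module Q = Invariant (invariant reaches)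
        module It = Iteration continue collects
        ∣P++Q∣ : fromℕ (length (P ++ Q.paths)) ≈ fromℕ (length P) + fromℕ (length Q.paths)
        ∣P++Q∣ = trans (reflexive (≡.cong fromℕ (List.length-++ P))) (×-homo-+ 1# (length P) _)

      final-bound : ∀ {t x 𝓕} → Enumerates 𝓕 IsFeasiblePath → Reaches k oracle (suc t) x →
        ‖ x ‖ ≤ ‖ x* ‖ * (C * (fromℕ (suc t) *
                  ln ((fromℕ (length 𝓕) * ε ⁻¹) * fromℕ (suc t) ⁻¹)))
      final-bound {t} {x} {𝓕} (_ , member) reaches = ≤-trans (bounded m 0<m)
        (≤-by (‖‖-nonneg x* ⊠ (proj₁ 0<C ⊠ x≤y⇒0≤y-x ratio≤t))
          (solve 5 (λ N C τ l ρ → N :* (C :* (τ :- ρ))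
              := N :* (C :* (τ :* l)) :- N :* (C :* (τ :* (l :- :1) :+ ρ))) refl
            (‖ x* ‖) C τ (ln m) (fromℕ (length paths) * ε ⁻¹ * m ⁻¹)))
        where
        open Invariant (invariant reaches)
        τ φ m : ℝ
        τ = fromℕ (suc t)
        φ = fromℕ (length 𝓕)
        -- The mean of the values ∣Pᵢ∣/ε if the sets exhaust 𝓕. With this m, the quotient ∣paths∣/(ε
        -- m) is at most τ and is absorbed by the -τ in τ (ln m - 1).
        m = (φ * ε ⁻¹) * τ ⁻¹
        0<τ : 0# < τ
        0<τ = 0<fromℕ {suc t} (ℕ.s≤s ℕ.z≤n)
        ∣paths∣≤∣𝓕∣ : length paths ℕ.≤ length 𝓕
        ∣paths∣≤∣𝓕∣ = Unique-length-≤ unique λ {p} p∈paths →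
          Equivalence.from (member p) (All.lookup feasible p∈paths)
        0<φ : 0# < φ
        0<φ = 0<fromℕ (ℕ.≤-trans (ℕ.s≤s ℕ.z≤n) (ℕ.≤-trans t≤∣paths∣ ∣paths∣≤∣𝓕∣))
        0<m : 0# < m
        0<m = *-pos (*-pos 0<φ 0<ε⁻¹) (⁻¹-pos 0<τ)
        φ/εm≈τ : φ * ε ⁻¹ * m ⁻¹ ≈ τ
        φ/εm≈τ = begin
          φ * ε ⁻¹ * m ⁻¹                ≈⟨ *-congʳ (*-identityʳ _) ⟨
          φ * ε ⁻¹ * 1# * m ⁻¹           ≈⟨ *-congʳ (*-congˡ (*-inverseˡ 0<τ)) ⟨
          φ * ε ⁻¹ * (τ ⁻¹ * τ) * m ⁻¹   ≈⟨ solve 4 (λ a i τ j → a :* (i :* τ) :* j := (j :* (a :* i)) :* τ)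
                                            refl _ _ _ _ ⟩
          m ⁻¹ * m * τ                   ≈⟨ *-congʳ (*-inverseˡ 0<m) ⟩
          1# * τ                         ≈⟨ *-identityˡ τ ⟩
          τ                              ∎
          where open SetoidReasoning setoid
        ratio≤t : fromℕ (length paths) * ε ⁻¹ * m ⁻¹ ≤ τ
        ratio≤t = ≤-trans
          (≤-by (x≤y⇒0≤y-x (fromℕ-mono ∣paths∣≤∣𝓕∣) ⊠ proj₁ 0<ε⁻¹ ⊠ proj₁ (⁻¹-pos 0<m))
            (solve 4 (λ q φ e i → (φ :- q) :* e :* i := φ :* e :* i :- q :* e :* i) refl _ _ _ _))
          (≤-reflexive φ/εm≈τ)

    output-bound : ∀ t {x 𝓕} → Enumerates 𝓕 IsFeasiblePath → Outputs k oracle t x →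
      ‖ x ‖ ≤ ‖ x* ‖ * (C * (fromℕ t * ln ((fromℕ (length 𝓕) * ε ⁻¹) * fromℕ t ⁻¹)))
    -- The factor t = 0 annihilates the logarithm, whose argument involves the unspecified inverse
    -- of 0.
    output-bound zero _ (start , _) = ≤-reflexive (trans ‖0‖
      (solve 3 (λ N C l → :0 := N :* (C :* (:0 :* l))) refl _ _ _))
    output-bound (suc t) enumerates (reaches@(step _ continue _) , stopped) =
      final-bound (≰⇒> λ T≤0 → stopped (continue-constant T≤0 continue)) enumerates reaches

theorem4 :
    (R : CompleteOrderedField) →
    let open CompleteOrderedField R
        open cLPI R
    in
    (ln : ℝ → ℝ) → IsNaturalLog ln →
    (C : ℝ) → 0# < C →
    ∃ λ (C′ : ℝ) → 0# < C′ ×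
      ((I : Instance) (ε : ℝ) → 0# < ε → ε < 1# →
       let open Paths I
           open Algorithm ln ε
       in
       (oracle : Oracle) → IsTBOracle C oracle →
       (k : ℕ) → NonZero k →
       (t : ℕ) (x : Impact) → Outputs k oracle t x →
       (x* : Impact) → IsOptimalSolution x* →
       (𝓕 : List Path) → Enumerates 𝓕 IsFeasiblePath →
       ‖ x ‖ ≤ ‖ x* ‖ * (C′ * (fromℕ t * ln ((fromℕ (length 𝓕) * ε ⁻¹) * fromℕ t ⁻¹))))
theorem4 R ln isNaturalLog C 0<C =
  -- The oracle's own constant serves as `C′`.
  C , 0<C , λ I ε 0<ε ε<1 oracle isTBOracle k k≢0 t x outputs x* (solution , _) 𝓕 enumerates →
    let open IncrementalInterdiction R ln isNaturalLog
        open Guarantee C 0<C I ε 0<ε ε<1 oracle isTBOracle k k≢0 x* solution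
    in output-bound t enumerates outputs
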